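{- (Provable in $\mathbf{HA}^\omega$.) Let $\tau,\sigma$ be finite types and $i=\max\{1+\mathrm{level}(\tau),\mathrm{level}(\sigma)\}$. Let $t\colon\tau^{\mathbb N}\to\mathbb N$ be a closed term in $\mathsf T_i$. Then there is a $\mathsf T_i$-term $\Phi^t$ such that for any bar $S$ securing $t$ and any $\Delta\colon(\tau^*\to\sigma)\to(\tau^*\to(\tau\to\sigma)\to\sigma)\to\tau^*\to\sigma$, $$\mathcal{GBR}_S(\Delta)\quad\Rightarrow\quad\mathcal{BR}(\Phi^t(\Delta),Y=t).$$
   Context: Finite types: $\mathbb N$ is a finite type, and if $\tau_0,\tau_1$ are finite types then so are $\tau_0\to\tau_1$ (also written $\tau_1^{\tau_0}$) and $\tau_0^*$ (finite sequences). Type levels: $\mathrm{level}(\mathbb N)=0$, $\mathrm{level}(\rho\to\eta)=\max\{\mathrm{level}(\rho)+1,\mathrm{level}(\eta)\}$, $\mathrm{level}(\tau^*)=\mathrm{level}(\tau)$. System $\mathsf T$ is the simply typed $\lambda$-calculus with $0$, $\mathsf{Succ}$ and recursors $\mathsf{Rec}^\rho$ for every finite type $\rho$, with $\mathsf{Rec}^\rho(a,f)(0)=a$, $\mathsf{Rec}^\rho(a,f)(\mathsf{Succ}(m))=f(m,\mathsf{Rec}^\rho(a,f)(m))$. $\mathsf T_i$ is the fragment in which $\mathsf{Rec}^\rho$ is restricted to $\mathrm{level}(\rho)\le i$. $\mathbf{HA}^\omega$ is intuitionistic Heyting arithmetic in all finite types. Notation: $|s|$ is the length of $s\colon\tau^*$;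 $s*x$ is $s$ with $x\colon\tau$ appended; $s*t$ and $s*\beta$ denote concatenation of $s$ with a finite sequence $t$ or infinite sequence $\beta\colon\tau^{\mathbb N}$; $\hat s\colon\mathbb N\to\tau$ extends $s$ by infinitely many zero objects $0^\tau$; $\bar\alpha n=\langle\alpha(0),\dots,\alpha(n-1)\rangle$. Bars: a predicate $S(s^{\tau^*})$ is a bar if it is (i) decidable: $\forall s(S(s)\vee\neg S(s))$; (ii) $\forall\alpha^{\tau^{\mathbb N}}\exists n^{\mathbb N}S(\bar\alpha n)$; (iii) monotone: $\forall s,t\,(S(s)\to S(s*t))$. A bar $S$ secures $Y\colon\tau^{\mathbb N}\to\mathbb N$ if for all $s^{\tau^*}$, $S(s)$ implies that $\lambda\beta.Y(s*\beta)$ is constant. For $\xi\colon(\tau^*\to\sigma)\to(\tau^*\to(\tau\to\sigma)\to\sigma)\to\tau^*\to\sigma$: - $\mathcal{GBR}_S(\xi)$ (general bar recursion) says: for all $G\colon\tau^*\to\sigma$, $H\colon\tau^*\to(\tau\to\sigma)\to\sigma$, $s\colon\tau^*$, if $S(s)$ then $\xi(G,H)(s)=G(s)$, and if $\neg S(s)$ then $\xi(G,H)(s)=H(s)(\lambda x^\tau.\xi(G,H)(s*x))$. - $\mathcal{BR}(\xi,Y=t)$ (Spector's bar recursion with $Y$ fixed to be $t$) says: for all $G,H,s$ of the same types, if $t(\hat s)<|s|$ then $\xi(G,H)(s)=G(s)$, and if $t(\hat s)\ge|s|$ then $\xi(G,H)(s)=H(s)(\lambda x^\tau.\xi(G,H)(s*x))$.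 -}

module Defs where

open import Data.Nat using (ℕ; suc; _⊔_; _≤_)
open import Data.List using (List; []; _∷_; map)
open import Data.List.Membership.Propositional using (_∈_)
open import Data.List.Relation.Binary.Subset.Propositional using (_⊆_)
open import Data.List.Relation.Unary.Any using (here; there)
open import Data.Product using (_×_)
open import Data.Unit using (⊤)
open import Relation.Binary.PropositionalEquality using (refl)

infixr 30 _⇒_
infixl 40 _*
infixl 50 _↑ _↑F _↑P _⟨_⟩ _[_]
infixl 25 _·_
infixl 23 _⁀_
infix  22 _≐_ _≺_ _≼_
infixr 21 _∧_
infixr 20 _∨_
infixr 19 _⊃_
infix  3  _⊢_
infix  3  _∈T_

data Ty : Set where
  N   : Ty
  _⇒_ : Ty → Ty → Ty
  _*  : Ty → Ty

level : Ty → ℕ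
level N       = 0
level (ρ ⇒ η) = suc (level ρ) ⊔ level η
level (ρ *)   = level ρ

Ctx : Set
Ctx = List Ty

-- Rec is the only recursor.  Finite sequences are handled by ⟨⟩, appending one
-- element, length, and lookup (which yields the zero object out of range);
-- everything else about them is defined from these by Rec.
data Con : Ty → Set where
  O    : Con N
  Succ : Con (N ⇒ N)
  Rec  : ∀ ρ → Con (ρ ⇒ (N ⇒ ρ ⇒ ρ) ⇒ N ⇒ ρ)
  nil  : ∀ {τ} → Con (τ *)
  snoc : ∀ {τ} → Con (τ * ⇒ τ ⇒ τ *)
  len  : ∀ {τ} → Con (τ * ⇒ N)
  look : ∀ {τ} → Con (τ * ⇒ N ⇒ τ)

-- Terms of system T, intrinsically typed, with de Bruijn variables.
data Tm (Γ : Ctx) : Ty → Set where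
  var : ∀ {ρ} → ρ ∈ Γ → Tm Γ ρ
  lam : ∀ {ρ η} → Tm (ρ ∷ Γ) η → Tm Γ (ρ ⇒ η)
  _·_ : ∀ {ρ η} → Tm Γ (ρ ⇒ η) → Tm Γ ρ → Tm Γ η
  con : ∀ {ρ} → Con ρ → Tm Γ ρ

ConIn : ∀ {ρ} → ℕ → Con ρ → Set
ConIn i (Rec ρ) = level ρ ≤ i
ConIn i O       = ⊤
ConIn i Succ    = ⊤
ConIn i nil     = ⊤
ConIn i snoc    = ⊤
ConIn i len     = ⊤
ConIn i look    = ⊤

-- a ∈T i : the term a belongs to the fragment T_i.
_∈T_ : ∀ {Γ ρ} → Tm Γ ρ → ℕ → Set
var x   ∈T i = ⊤
lam a   ∈T i = a ∈T i
(a · b) ∈T i = (a ∈T i) × (b ∈T i)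
con c   ∈T i = ConIn i c

lift : ∀ {Γ Δ : Ctx} {ρ} → Γ ⊆ Δ → (ρ ∷ Γ) ⊆ (ρ ∷ Δ)
lift r (here p)  = here p
lift r (there x) = there (r x)

ren : ∀ {Γ Δ ρ} → Γ ⊆ Δ → Tm Γ ρ → Tm Δ ρ
ren r (var x) = var (r x)
ren r (lam a) = lam (ren (lift r) a)
ren r (a · b) = ren r a · ren r b
ren r (con c) = con c

_↑ : ∀ {Γ ρ η} → Tm Γ ρ → Tm (η ∷ Γ) ρ
a ↑ = ren there a

closed : ∀ {Γ ρ} → Tm [] ρ → Tm Γ ρ
closed = ren (λ ())

Sub : Ctx → Ctx → Set
Sub Γ Δ = ∀ {ρ} → ρ ∈ Γ → Tm Δ ρ

_◂_ : ∀ {Γ Δ ρ} → Tm Δ ρ → Sub Γ Δ → Sub (ρ ∷ Γ) Δ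
(a ◂ s) (here refl) = a
(a ◂ s) (there x)   = s x

exts : ∀ {Γ Δ ρ} → Sub Γ Δ → Sub (ρ ∷ Γ) (ρ ∷ Δ)
exts s (here p)  = var (here p)
exts s (there x) = s x ↑

sub : ∀ {Γ Δ ρ} → Sub Γ Δ → Tm Γ ρ → Tm Δ ρ
sub s (var x) = s x
sub s (lam a) = lam (sub (exts s) a)
sub s (a · b) = sub s a · sub s b
sub s (con c) = con c

_[_] : ∀ {Γ ρ η} → Tm (ρ ∷ Γ) η → Tm Γ ρ → Tm Γ η
b [ a ] = sub (a ◂ var) b

v0 : ∀ {Γ ρ} → Tm (ρ ∷ Γ) ρ
v0 = var (here refl)

v1 : ∀ {Γ ρ η} → Tm (η ∷ ρ ∷ Γ) ρ
v1 = v0 ↑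

v2 : ∀ {Γ ρ η ζ} → Tm (ζ ∷ η ∷ ρ ∷ Γ) ρ
v2 = v1 ↑

v3 : ∀ {Γ ρ η ζ θ} → Tm (θ ∷ ζ ∷ η ∷ ρ ∷ Γ) ρ
v3 = v2 ↑

v4 : ∀ {Γ ρ η ζ θ κ} → Tm (κ ∷ θ ∷ ζ ∷ η ∷ ρ ∷ Γ) ρ
v4 = v3 ↑

zeroObj : ∀ {Γ} ρ → Tm Γ ρ
zeroObj N       = con O
zeroObj (ρ ⇒ η) = lam (zeroObj η)
zeroObj (ρ *)   = con nil

pred : ∀ {Γ} → Tm Γ (N ⇒ N)
pred = lam (con (Rec N) · con O · lam (lam v1) · v0)

monus : ∀ {Γ} → Tm Γ (N ⇒ N ⇒ N)
monus = lam (lam (con (Rec N) · v1 · lam (lam (pred · v0)) · v0))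

-- s * t for a finite sequence t.
append : ∀ {Γ τ} → Tm Γ (τ * ⇒ τ * ⇒ τ *)
append {τ = τ} =
  lam (lam (con (Rec (τ *)) · v1
                            · lam (lam (con snoc · v0 · (con look · v2 · v1)))
                            · (con len · v0)))

-- s * β for an infinite sequence β : at n, the value is the n-th element of s
-- if (n + 1) ∸ |s| = 0, i.e. if n < |s|, and β(n ∸ |s|) otherwise.
prepend : ∀ {Γ τ} → Tm Γ (τ * ⇒ (N ⇒ τ) ⇒ N ⇒ τ)
prepend {τ = τ} =
  lam (lam (lam (con (Rec τ) · (con look · v2 · v0)
                             · lam (lam (v3 · (monus · v2 · (con len · v4))))
                             · (monus · (con Succ · v0) · (con len · v2)))))

_⁀_ : ∀ {Γ τ} → Tm Γ (τ *) → Tm Γ (N ⇒ τ) → Tm Γ (N ⇒ τ)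
s ⁀ β = prepend · s · β

hat : ∀ {Γ τ} → Tm Γ (τ *) → Tm Γ (N ⇒ τ)
hat {τ = τ} s = s ⁀ lam (zeroObj τ)

-- The initial segment ⟨α(0), …, α(n − 1)⟩.
initSeg : ∀ {Γ τ} → Tm Γ ((N ⇒ τ) ⇒ N ⇒ τ *)
initSeg {τ = τ} =
  lam (lam (con (Rec (τ *)) · con nil
                            · lam (lam (con snoc · v0 · (v3 · v1)))
                            · v0))

data Fm (Γ : Ctx) : Set where
  _≐_ : ∀ {ρ} → Tm Γ ρ → Tm Γ ρ → Fm Γ
  ⊥'  : Fm Γ
  _∧_ : Fm Γ → Fm Γ → Fm Γ
  _∨_ : Fm Γ → Fm Γ → Fm Γ
  _⊃_ : Fm Γ → Fm Γ → Fm Γ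
  ∀'  : ∀ ρ → Fm (ρ ∷ Γ) → Fm Γ
  ∃'  : ∀ ρ → Fm (ρ ∷ Γ) → Fm Γ

¬' : ∀ {Γ} → Fm Γ → Fm Γ
¬' A = A ⊃ ⊥'

_≼_ : ∀ {Γ} → Tm Γ N → Tm Γ N → Fm Γ
a ≼ b = monus · a · b ≐ con O

_≺_ : ∀ {Γ} → Tm Γ N → Tm Γ N → Fm Γ
a ≺ b = con Succ · a ≼ b

renF : ∀ {Γ Δ} → Γ ⊆ Δ → Fm Γ → Fm Δ
renF r (a ≐ b)  = ren r a ≐ ren r b
renF r ⊥'       = ⊥'
renF r (A ∧ B)  = renF r A ∧ renF r B
renF r (A ∨ B)  = renF r A ∨ renF r B
renF r (A ⊃ B)  = renF r A ⊃ renF r B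
renF r (∀' ρ A) = ∀' ρ (renF (lift r) A)
renF r (∃' ρ A) = ∃' ρ (renF (lift r) A)

subF : ∀ {Γ Δ} → Sub Γ Δ → Fm Γ → Fm Δ
subF s (a ≐ b)  = sub s a ≐ sub s b
subF s ⊥'       = ⊥'
subF s (A ∧ B)  = subF s A ∧ subF s B
subF s (A ∨ B)  = subF s A ∨ subF s B
subF s (A ⊃ B)  = subF s A ⊃ subF s B
subF s (∀' ρ A) = ∀' ρ (subF (exts s) A)
subF s (∃' ρ A) = ∃' ρ (subF (exts s) A)

_↑F : ∀ {Γ ρ} → Fm Γ → Fm (ρ ∷ Γ)
A ↑F = renF there A

-- A predicate on ρ with parameters Γ is a formula with one further free
-- variable; P ↑P adds a parameter and P ⟨ a ⟩ is the instance P(a).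
Pred : Ctx → Ty → Set
Pred Γ ρ = Fm (ρ ∷ Γ)

_↑P : ∀ {Γ ρ η} → Pred Γ ρ → Pred (η ∷ Γ) ρ
P ↑P = renF (lift there) P

_⟨_⟩ : ∀ {Γ ρ} → Pred Γ ρ → Tm Γ ρ → Fm Γ
P ⟨ a ⟩ = subF (a ◂ var) P

-- Provability in HA^ω, in natural deduction: Θ ⊢ A means that A is derivable
-- from the assumptions Θ, where Γ lists the free variables.  Equality is
-- available at every type and is extensional at function types.
data _⊢_ {Γ : Ctx} (Θ : List (Fm Γ)) : Fm Γ → Set where
  hyp  : ∀ {A} → A ∈ Θ → Θ ⊢ A
  ⊥E   : ∀ {A} → Θ ⊢ ⊥' → Θ ⊢ A
  ∧I   : ∀ {A B} → Θ ⊢ A → Θ ⊢ B → Θ ⊢ A ∧ B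
  ∧E₁  : ∀ {A B} → Θ ⊢ A ∧ B → Θ ⊢ A
  ∧E₂  : ∀ {A B} → Θ ⊢ A ∧ B → Θ ⊢ B
  ∨I₁  : ∀ {A B} → Θ ⊢ A → Θ ⊢ A ∨ B
  ∨I₂  : ∀ {A B} → Θ ⊢ B → Θ ⊢ A ∨ B
  ∨E   : ∀ {A B C} → Θ ⊢ A ∨ B → A ∷ Θ ⊢ C → B ∷ Θ ⊢ C → Θ ⊢ C
  ⊃I   : ∀ {A B} → A ∷ Θ ⊢ B → Θ ⊢ A ⊃ B
  ⊃E   : ∀ {A B} → Θ ⊢ A ⊃ B → Θ ⊢ A → Θ ⊢ B
  ∀I   : ∀ {ρ A} → map _↑F Θ ⊢ A → Θ ⊢ ∀' ρ A
  ∀E   : ∀ {ρ A} → Θ ⊢ ∀' ρ A → (a : Tm Γ ρ) → Θ ⊢ A ⟨ a ⟩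
  ∃I   : ∀ {ρ A} (a : Tm Γ ρ) → Θ ⊢ A ⟨ a ⟩ → Θ ⊢ ∃' ρ A
  ∃E   : ∀ {ρ A C} → Θ ⊢ ∃' ρ A → A ∷ map _↑F Θ ⊢ C ↑F → Θ ⊢ C

  ≐-refl  : ∀ {ρ} {a : Tm Γ ρ} → Θ ⊢ a ≐ a
  ≐-subst : ∀ {ρ} (A : Pred Γ ρ) {a b} → Θ ⊢ a ≐ b → Θ ⊢ A ⟨ a ⟩ → Θ ⊢ A ⟨ b ⟩
  ≐-ext   : ∀ {ρ η} {f g : Tm Γ (ρ ⇒ η)} →
            Θ ⊢ ∀' ρ (f ↑ · v0 ≐ g ↑ · v0) → Θ ⊢ f ≐ g
  β       : ∀ {ρ η} {b : Tm (ρ ∷ Γ) η} {a : Tm Γ ρ} → Θ ⊢ lam b · a ≐ b [ a ]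

  Succ≢O   : ∀ {n} → Θ ⊢ con Succ · n ≐ con O → Θ ⊢ ⊥'
  Succ-inj : ∀ {m n} → Θ ⊢ con Succ · m ≐ con Succ · n → Θ ⊢ m ≐ n
  ind      : (A : Pred Γ N) → Θ ⊢ A ⟨ con O ⟩ →
             Θ ⊢ ∀' N (A ⊃ A ↑P ⟨ con Succ · v0 ⟩) → Θ ⊢ ∀' N A
  Rec-O    : ∀ {ρ a f} → Θ ⊢ con (Rec ρ) · a · f · con O ≐ a
  Rec-Succ : ∀ {ρ a f m} → Θ ⊢ con (Rec ρ) · a · f · (con Succ · m)
                             ≐ f · m · (con (Rec ρ) · a · f · m)

  len-nil  : ∀ {τ} → Θ ⊢ con len · con (nil {τ}) ≐ con O
  len-snoc : ∀ {τ} {s : Tm Γ (τ *)} {x} →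
             Θ ⊢ con len · (con snoc · s · x) ≐ con Succ · (con len · s)
  look-<   : ∀ {τ} {s : Tm Γ (τ *)} {x n} → Θ ⊢ n ≺ con len · s →
             Θ ⊢ con look · (con snoc · s · x) · n ≐ con look · s · n
  look-=   : ∀ {τ} {s : Tm Γ (τ *)} {x} →
             Θ ⊢ con look · (con snoc · s · x) · (con len · s) ≐ x
  look-≥   : ∀ {τ} {s : Tm Γ (τ *)} {n} → Θ ⊢ con len · s ≼ n →
             Θ ⊢ con look · s · n ≐ zeroObj τ
  *-ext    : ∀ {τ} {s u : Tm Γ (τ *)} → Θ ⊢ con len · s ≐ con len · u →
             Θ ⊢ ∀' N (v0 ≺ con len · s ↑ ⊃ con look · s ↑ · v0 ≐ con look · u ↑ · v0) →
             Θ ⊢ s ≐ u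

Bar : ∀ {Γ τ} → Pred Γ (τ *) → Fm Γ
Bar {τ = τ} S =
    ∀' (τ *) (S ↑P ⟨ v0 ⟩ ∨ ¬' (S ↑P ⟨ v0 ⟩))
  ∧ ∀' (N ⇒ τ) (∃' N (S ↑P ↑P ⟨ initSeg · v1 · v0 ⟩))
  ∧ ∀' (τ *) (∀' (τ *) (S ↑P ↑P ⟨ v1 ⟩ ⊃ S ↑P ↑P ⟨ append · v1 · v0 ⟩))

Secures : ∀ {Γ τ} → Pred Γ (τ *) → Tm Γ ((N ⇒ τ) ⇒ N) → Fm Γ
Secures {τ = τ} S Y =
  ∀' (τ *) (S ↑P ⟨ v0 ⟩ ⊃
    ∀' (N ⇒ τ) (∀' (N ⇒ τ) (Y ↑ ↑ ↑ · (v2 ⁀ v1) ≐ Y ↑ ↑ ↑ · (v2 ⁀ v0))))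

BRTy : Ty → Ty → Ty
BRTy τ σ = (τ * ⇒ σ) ⇒ (τ * ⇒ (τ ⇒ σ) ⇒ σ) ⇒ τ * ⇒ σ

-- The common shape of both forms of bar recursion: for all G, H and s,
-- if Stop(s) then ξ(G,H)(s) = G(s), and
-- if Go(s) then ξ(G,H)(s) = H(s)(λx. ξ(G,H)(s * x)).
BarRec : ∀ {Γ τ σ} → (Stop Go : Pred Γ (τ *)) → Tm Γ (BRTy τ σ) → Fm Γ
BarRec {τ = τ} {σ} Stop Go ξ =
  ∀' (τ * ⇒ σ) (∀' (τ * ⇒ (τ ⇒ σ) ⇒ σ) (∀' (τ *)
    ( (Stop ↑P ↑P ↑P ⟨ v0 ⟩ ⊃ ξ ↑ ↑ ↑ · v2 · v1 · v0 ≐ v2 · v0)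
    ∧ (Go ↑P ↑P ↑P ⟨ v0 ⟩ ⊃
         ξ ↑ ↑ ↑ · v2 · v1 · v0
           ≐ v1 · v0 · lam (ξ ↑ ↑ ↑ ↑ · v3 · v2 · (con snoc · v1 · v0))))))

GBR : ∀ {Γ τ σ} → Pred Γ (τ *) → Tm Γ (BRTy τ σ) → Fm Γ
GBR S = BarRec S (¬' S)

BR : ∀ {Γ τ σ} → Tm Γ (BRTy τ σ) → Tm Γ ((N ⇒ τ) ⇒ N) → Fm Γ
BR ξ Y = BarRec (Y ↑ · hat v0 ≺ con len · v0) (con len · v0 ≼ Y ↑ · hat v0) ξ

module Submission where

-- Let m(s) = (t(ŝ) + 1) ∸ |s|, so that m(s) = 0 iff t(ŝ) < |s|.  If S(s), then t(û) = t(ŝ)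
-- for every extension u of s, hence m drops by one with each appended element, and Spector's
-- recursion from s is an ordinary recursion of length m(s): put
--   G'(s) = Rec(G, λn f s. H(s)(λx. f(s * x)))(m(s))(s).
-- If ¬S(s), one step of Spector's recursion is a step of general bar recursion with
--   H'(s)(f) = G(s) if m(s) = 0, and H(s)(f) otherwise.
-- Thus Φ(Δ)(G, H) = Δ(G', H'), and this does not mention S.

open import Defs
open import Data.Nat using (ℕ; zero; suc; _+_; _⊔_; _≤_; z≤n)
open import Data.Nat.Properties using (≤-refl; ≤-trans; n≤1+n; m≤m⊔n; m≤n⊔m)
open import Data.List using (List; []; _∷_; map)
open import Data.List.Membership.Propositional using (_∈_)
open import Data.List.Membership.Propositional.Properties using (∈-map⁺; ∈-map⁻)
open import Data.List.Relation.Binary.Subset.Propositional using (_⊆_)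
open import Data.List.Relation.Unary.Any using (here; there)
open import Data.Product using (Σ-syntax; _×_; _,_; proj₁; proj₂)
open import Data.Unit using (tt)
open import Relation.Binary.PropositionalEquality
  using (_≡_; refl; sym; trans; cong; cong₂; subst)

private variable
  Γ Δ Ξ : Ctx
  ρ η τ σ : Ty

-- Renaming and substitution

_≗_ : Sub Γ Δ → Sub Γ Δ → Set
_≗_ {Γ} s s' = ∀ {ρ} (x : ρ ∈ Γ) → s x ≡ s' x

exts-cong : {s s' : Sub Γ Δ} → s ≗ s' → exts {ρ = η} s ≗ exts s'
exts-cong e (here p)  = refl
exts-cong e (there x) = cong _↑ (e x)

sub-cong : {s s' : Sub Γ Δ} → s ≗ s' → (a : Tm Γ ρ) → sub s a ≡ sub s' a
sub-cong e (var x) = e x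
sub-cong e (lam a) = cong lam (sub-cong (exts-cong e) a)
sub-cong e (a · b) = cong₂ _·_ (sub-cong e a) (sub-cong e b)
sub-cong e (con c) = refl

exts-var : exts {Γ} {ρ = η} var ≗ var
exts-var (here p)  = refl
exts-var (there x) = refl

sub-var : (a : Tm Γ ρ) → sub var a ≡ a
sub-var (var x) = refl
sub-var (lam a) = cong lam (trans (sub-cong exts-var a) (sub-var a))
sub-var (a · b) = cong₂ _·_ (sub-var a) (sub-var b)
sub-var (con c) = refl

ren≡sub : (r : Γ ⊆ Δ) (a : Tm Γ ρ) → ren r a ≡ sub (λ x → var (r x)) a
ren≡sub r (var x) = refl
ren≡sub r (lam a) = cong lam (trans (ren≡sub (lift r) a)
  (sub-cong (λ { (here p) → refl ; (there x) → refl }) a))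
ren≡sub r (a · b) = cong₂ _·_ (ren≡sub r a) (ren≡sub r b)
ren≡sub r (con c) = refl

sub-ren : (s : Sub Δ Ξ) (r : Γ ⊆ Δ) (a : Tm Γ ρ) →
          sub s (ren r a) ≡ sub (λ x → s (r x)) a
sub-ren s r (var x) = refl
sub-ren s r (lam a) = cong lam (trans (sub-ren (exts s) (lift r) a)
  (sub-cong (λ { (here p) → refl ; (there x) → refl }) a))
sub-ren s r (a · b) = cong₂ _·_ (sub-ren s r a) (sub-ren s r b)
sub-ren s r (con c) = refl

ren-↑ : (r : Γ ⊆ Δ) (a : Tm Γ ρ) → ren (lift {ρ = η} r) (a ↑) ≡ ren r a ↑
ren-↑ r a = trans (ren≡sub (lift r) (a ↑)) (trans (sub-ren _ there a)
  (sym (trans (ren≡sub there (ren r a)) (sub-ren _ r a))))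

ren-sub : (r : Δ ⊆ Ξ) (s : Sub Γ Δ) (a : Tm Γ ρ) →
          ren r (sub s a) ≡ sub (λ x → ren r (s x)) a
ren-sub r s (var x) = refl
ren-sub r s (lam a) = cong lam (trans (ren-sub (lift r) (exts s) a)
  (sub-cong (λ { (here p) → refl ; (there x) → ren-↑ r (s x) }) a))
ren-sub r s (a · b) = cong₂ _·_ (ren-sub r s a) (ren-sub r s b)
ren-sub r s (con c) = refl

sub-↑ : (s : Sub Γ Δ) (a : Tm Γ ρ) → sub (exts {ρ = η} s) (a ↑) ≡ sub s a ↑
sub-↑ s a = trans (sub-ren (exts s) there a) (sym (ren-sub there s a))

sub-sub : (s' : Sub Δ Ξ) (s : Sub Γ Δ) (a : Tm Γ ρ) →
          sub s' (sub s a) ≡ sub (λ x → sub s' (s x)) a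
sub-sub s' s (var x) = refl
sub-sub s' s (lam a) = cong lam (trans (sub-sub (exts s') (exts s) a)
  (sub-cong (λ { (here p) → refl ; (there x) → sub-↑ s' (s x) }) a))
sub-sub s' s (a · b) = cong₂ _·_ (sub-sub s' s a) (sub-sub s' s b)
sub-sub s' s (con c) = refl

sub-zeroObj : (s : Sub Γ Δ) → ∀ ρ → sub s (zeroObj ρ) ≡ zeroObj ρ
sub-zeroObj s N       = refl
sub-zeroObj s (ρ ⇒ η) = cong lam (sub-zeroObj (exts s) η)
sub-zeroObj s (ρ *)   = refl

↑-inst : (b : Tm Γ η) (a : Tm Γ ρ) → (a ↑) [ b ] ≡ a
↑-inst b a = trans (sub-ren _ there a) (sub-var a)

sub-inst : (s : Sub Γ Δ) (b : Tm (ρ ∷ Γ) η) (a : Tm Γ ρ) →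
           sub s (b [ a ]) ≡ sub (exts s) b [ sub s a ]
sub-inst s b a = trans (sub-sub s _ b) (trans
  (sub-cong (λ { (here refl) → refl ; (there x) → sym (↑-inst _ (s x)) }) b)
  (sym (sub-sub _ (exts s) b)))

subF-cong : {s s' : Sub Γ Δ} → s ≗ s' → (A : Fm Γ) → subF s A ≡ subF s' A
subF-cong e (a ≐ b)  = cong₂ _≐_ (sub-cong e a) (sub-cong e b)
subF-cong e ⊥'       = refl
subF-cong e (A ∧ B)  = cong₂ _∧_ (subF-cong e A) (subF-cong e B)
subF-cong e (A ∨ B)  = cong₂ _∨_ (subF-cong e A) (subF-cong e B)
subF-cong e (A ⊃ B)  = cong₂ _⊃_ (subF-cong e A) (subF-cong e B)
subF-cong e (∀' ρ A) = cong (∀' ρ) (subF-cong (exts-cong e) A)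
subF-cong e (∃' ρ A) = cong (∃' ρ) (subF-cong (exts-cong e) A)

renF≡subF : (r : Γ ⊆ Δ) (A : Fm Γ) → renF r A ≡ subF (λ x → var (r x)) A
renF≡subF r (a ≐ b)  = cong₂ _≐_ (ren≡sub r a) (ren≡sub r b)
renF≡subF r ⊥'       = refl
renF≡subF r (A ∧ B)  = cong₂ _∧_ (renF≡subF r A) (renF≡subF r B)
renF≡subF r (A ∨ B)  = cong₂ _∨_ (renF≡subF r A) (renF≡subF r B)
renF≡subF r (A ⊃ B)  = cong₂ _⊃_ (renF≡subF r A) (renF≡subF r B)
renF≡subF r (∀' ρ A) = cong (∀' ρ) (trans (renF≡subF (lift r) A)
  (subF-cong (λ { (here p) → refl ; (there x) → refl }) A))
renF≡subF r (∃' ρ A) = cong (∃' ρ) (trans (renF≡subF (lift r) A)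
  (subF-cong (λ { (here p) → refl ; (there x) → refl }) A))

exts-sub : (s' : Sub Δ Ξ) (s : Sub Γ Δ) →
           (λ x → sub (exts {ρ = η} s') (exts s x)) ≗ exts (λ x → sub s' (s x))
exts-sub s' s (here p)  = refl
exts-sub s' s (there x) = sub-↑ s' (s x)

subF-subF : (s' : Sub Δ Ξ) (s : Sub Γ Δ) (A : Fm Γ) →
            subF s' (subF s A) ≡ subF (λ x → sub s' (s x)) A
subF-subF s' s (a ≐ b)  = cong₂ _≐_ (sub-sub s' s a) (sub-sub s' s b)
subF-subF s' s ⊥'       = refl
subF-subF s' s (A ∧ B)  = cong₂ _∧_ (subF-subF s' s A) (subF-subF s' s B)
subF-subF s' s (A ∨ B)  = cong₂ _∨_ (subF-subF s' s A) (subF-subF s' s B)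
subF-subF s' s (A ⊃ B)  = cong₂ _⊃_ (subF-subF s' s A) (subF-subF s' s B)
subF-subF s' s (∀' ρ A) = cong (∀' ρ) (trans (subF-subF (exts s') (exts s) A)
  (subF-cong (exts-sub s' s) A))
subF-subF s' s (∃' ρ A) = cong (∃' ρ) (trans (subF-subF (exts s') (exts s) A)
  (subF-cong (exts-sub s' s) A))

subF-renF : (s : Sub Δ Ξ) (r : Γ ⊆ Δ) (A : Fm Γ) →
            subF s (renF r A) ≡ subF (λ x → s (r x)) A
subF-renF s r A = trans (cong (subF s) (renF≡subF r A)) (subF-subF s _ A)

renF-subF : (r : Δ ⊆ Ξ) (s : Sub Γ Δ) (A : Fm Γ) →
            renF r (subF s A) ≡ subF (λ x → ren r (s x)) A
renF-subF r s A = trans (renF≡subF r _) (trans (subF-subF _ s A)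
  (subF-cong (λ x → sym (ren≡sub r (s x))) A))

subF-var : (A : Fm Γ) → subF var A ≡ A
subF-var (a ≐ b)  = cong₂ _≐_ (sub-var a) (sub-var b)
subF-var ⊥'       = refl
subF-var (A ∧ B)  = cong₂ _∧_ (subF-var A) (subF-var B)
subF-var (A ∨ B)  = cong₂ _∨_ (subF-var A) (subF-var B)
subF-var (A ⊃ B)  = cong₂ _⊃_ (subF-var A) (subF-var B)
subF-var (∀' ρ A) = cong (∀' ρ) (trans (subF-cong exts-var A) (subF-var A))
subF-var (∃' ρ A) = cong (∃' ρ) (trans (subF-cong exts-var A) (subF-var A))

subF-↑F : (s : Sub Γ Δ) (A : Fm Γ) → subF (exts {ρ = η} s) (A ↑F) ≡ subF s A ↑F
subF-↑F s A = trans (subF-renF (exts s) there A) (sym (renF-subF there s A))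

subF-⟨⟩ : (s : Sub Γ Δ) (A : Pred Γ ρ) (a : Tm Γ ρ) →
          subF s (A ⟨ a ⟩) ≡ subF (exts s) A ⟨ sub s a ⟩
subF-⟨⟩ s A a = trans (subF-subF s _ A) (trans
  (subF-cong (λ { (here refl) → refl ; (there x) → sym (↑-inst _ (s x)) }) A)
  (sym (subF-subF _ (exts s) A)))

subF-step : (s : Sub Γ Δ) (A : Pred Γ N) →
  subF (exts s) (A ↑P ⟨ con Succ · v0 ⟩) ≡ subF (exts s) A ↑P ⟨ con Succ · v0 ⟩
subF-step s A = trans (cong (subF (exts s)) (subF-renF _ (lift there) A)) (trans
  (subF-subF (exts s) _ A) (trans
  (subF-cong (λ { (here refl) → refl ; (there x) → sym (trans
     (sub-ren _ there (s x)) (sym (ren≡sub there (s x)))) }) A)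
  (sym (trans (subF-renF _ (lift there) (subF (exts s) A)) (subF-subF _ (exts s) A)))))

-- Derivations are closed under substitution and weakening

conv : {Θ : List (Fm Γ)} {A B : Fm Γ} → A ≡ B → Θ ⊢ A → Θ ⊢ B
conv refl d = d

conv-r : {Θ : List (Fm Γ)} {a b c : Tm Γ ρ} → b ≡ c → Θ ⊢ a ≐ b → Θ ⊢ a ≐ c
conv-r refl d = d

-- Assumptions are compared after applying `s`, so that substitution of terms and weakening of
-- assumptions become one induction.
_⊆[_]_ : List (Fm Γ) → Sub Γ Δ → List (Fm Δ) → Set
Θ ⊆[ s ] Θ' = ∀ {A} → A ∈ Θ → subF s A ∈ Θ'

⊆-∷ : {s : Sub Γ Δ} {Θ : List (Fm Γ)} {Θ' : List (Fm Δ)} {B : Fm Γ} →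
      Θ ⊆[ s ] Θ' → (B ∷ Θ) ⊆[ s ] (subF s B ∷ Θ')
⊆-∷ i (here refl) = here refl
⊆-∷ i (there x)   = there (i x)

⊆-↑ : {s : Sub Γ Δ} {Θ : List (Fm Γ)} {Θ' : List (Fm Δ)} →
      Θ ⊆[ s ] Θ' → map (_↑F {ρ = η}) Θ ⊆[ exts s ] map _↑F Θ'
⊆-↑ {s = s} {Θ' = Θ'} i x with ∈-map⁻ _↑F x
... | A , y , refl = subst (_∈ map _↑F Θ') (sym (subF-↑F s A)) (∈-map⁺ _↑F (i y))

-- Induction on the derivation. Rules that mention an instance, a shift or `zeroObj` need the
-- commutation lemmas above, since there both sides agree only propositionally; the other rules are
-- stable by computation.
⊢-sub : {Θ : List (Fm Γ)} {Θ' : List (Fm Δ)} {A : Fm Γ} (s : Sub Γ Δ) →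
        Θ ⊆[ s ] Θ' → Θ ⊢ A → Θ' ⊢ subF s A
⊢-sub s i (hyp x) = hyp (i x)
⊢-sub s i (⊥E d) = ⊥E (⊢-sub s i d)
⊢-sub s i (∧I d e) = ∧I (⊢-sub s i d) (⊢-sub s i e)
⊢-sub s i (∧E₁ d) = ∧E₁ (⊢-sub s i d)
⊢-sub s i (∧E₂ d) = ∧E₂ (⊢-sub s i d)
⊢-sub s i (∨I₁ d) = ∨I₁ (⊢-sub s i d)
⊢-sub s i (∨I₂ d) = ∨I₂ (⊢-sub s i d)
⊢-sub s i (∨E d e f) = ∨E (⊢-sub s i d) (⊢-sub s (⊆-∷ i) e) (⊢-sub s (⊆-∷ i) f)
⊢-sub s i (⊃I d) = ⊃I (⊢-sub s (⊆-∷ i) d)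
⊢-sub s i (⊃E d e) = ⊃E (⊢-sub s i d) (⊢-sub s i e)
⊢-sub s i (∀I d) = ∀I (⊢-sub (exts s) (⊆-↑ i) d)
⊢-sub s i (∀E {A = A} d a) = conv (sym (subF-⟨⟩ s A a)) (∀E (⊢-sub s i d) (sub s a))
⊢-sub s i (∃I {A = A} a d) = ∃I (sub s a) (conv (subF-⟨⟩ s A a) (⊢-sub s i d))
⊢-sub s i (∃E {C = C} d e) =
  ∃E (⊢-sub s i d) (conv (subF-↑F s C) (⊢-sub (exts s) (⊆-∷ (⊆-↑ i)) e))
⊢-sub s i ≐-refl = ≐-refl
⊢-sub s i (≐-subst A {a} {b} d e) = conv (sym (subF-⟨⟩ s A b))
  (≐-subst (subF (exts s) A) (⊢-sub s i d) (conv (subF-⟨⟩ s A a) (⊢-sub s i e)))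
⊢-sub s i (≐-ext {f = f} {g} d) = ≐-ext (conv
  (cong (∀' _) (cong₂ (λ a b → a · v0 ≐ b · v0) (sub-↑ s f) (sub-↑ s g))) (⊢-sub s i d))
⊢-sub s i (β {b = b} {a}) = conv-r (sym (sub-inst s b a)) (β {b = sub (exts s) b} {sub s a})
⊢-sub s i (Succ≢O d) = Succ≢O (⊢-sub s i d)
⊢-sub s i (Succ-inj d) = Succ-inj (⊢-sub s i d)
⊢-sub s i (ind A d e) = ind (subF (exts s) A)
  (conv (subF-⟨⟩ s A (con O)) (⊢-sub s i d))
  (conv (cong (λ B → ∀' N (subF (exts s) A ⊃ B)) (subF-step s A)) (⊢-sub s i e))
⊢-sub s i Rec-O = Rec-O
⊢-sub s i Rec-Succ = Rec-Succ
⊢-sub s i len-nil = len-nil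
⊢-sub s i len-snoc = len-snoc
⊢-sub s i (look-< d) = look-< (⊢-sub s i d)
⊢-sub s i look-= = look-=
⊢-sub s i (look-≥ {τ = τ} d) = conv-r (sym (sub-zeroObj s τ)) (look-≥ (⊢-sub s i d))
⊢-sub s i (*-ext {s = a} {b} d e) = *-ext (⊢-sub s i d) (conv
  (cong (∀' N) (cong₂ (λ a b → v0 ≺ con len · a ⊃ con look · a · v0 ≐ con look · b · v0)
    (sub-↑ s a) (sub-↑ s b))) (⊢-sub s i e))

-- Substitution into variables computes, so equations are derived for variables and
-- transferred to arbitrary terms by inst.
inst : {Θ : List (Fm Δ)} {A : Fm Γ} → [] ⊢ A → (s : Sub Γ Δ) → Θ ⊢ subF s A
inst d s = ⊢-sub s (λ ()) d

-- Equational reasoning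

private variable
  Θ : List (Fm Γ)
  a a' b b' c : Tm Γ ρ

≐-sym : Θ ⊢ a ≐ b → Θ ⊢ b ≐ a
≐-sym {a = a} {b} d = conv (cong (b ≐_) (↑-inst b a))
  (≐-subst (v0 ≐ a ↑) d (conv (cong (a ≐_) (sym (↑-inst a a))) ≐-refl))

≐-trans : Θ ⊢ a ≐ b → Θ ⊢ b ≐ c → Θ ⊢ a ≐ c
≐-trans {a = a} {b} {c} d e = conv (cong (_≐ c) (↑-inst c a))
  (≐-subst (a ↑ ≐ v0) e (conv (cong (_≐ b) (sym (↑-inst b a))) d))

≐-app : {f g : Tm Γ (ρ ⇒ η)} {a b : Tm Γ ρ} →
        Θ ⊢ f ≐ g → Θ ⊢ a ≐ b → Θ ⊢ f · a ≐ g · b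
≐-app {f = f} {g} {a} {b} d e = ≐-trans
  (conv (cong₂ (λ h c → h · c ≐ g · c) (↑-inst g f) (↑-inst g a))
    (≐-subst (f ↑ · a ↑ ≐ v0 · a ↑) d
      (conv (cong₂ (λ h c → h · c ≐ f · c) (sym (↑-inst f f)) (sym (↑-inst f a))) ≐-refl)))
  (conv (cong₂ (λ h c → h · c ≐ h · b) (↑-inst b g) (↑-inst b a))
    (≐-subst (g ↑ · a ↑ ≐ g ↑ · v0) e
      (conv (cong₂ (λ h c → h · c ≐ h · a) (sym (↑-inst a g)) (sym (↑-inst a a))) ≐-refl)))

η-inst : (b : Tm (ρ ∷ Γ) η) → ren (lift there) b [ v0 ] ≡ b
η-inst b = trans (sub-ren _ (lift there) b)
  (trans (sub-cong (λ { (here refl) → refl ; (there x) → refl }) b) (sub-var b))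

-- The ξ rule, obtained from extensionality: applied to the fresh variable, both abstractions
-- contract to their bodies. It lets `simp` rewrite under binders.
≐-lam : {b b' : Tm (ρ ∷ Γ) η} → map _↑F Θ ⊢ b ≐ b' → Θ ⊢ lam b ≐ lam b'
≐-lam {b = b} {b'} d = ≐-ext (∀I (≐-trans (conv-r (η-inst b) β)
  (≐-trans d (≐-sym (conv-r (η-inst b') β)))))

-- Simplification of terms, with derivations of the equalities

Reduct : Tm Γ ρ → Set
Reduct {Γ} {ρ} a = Σ[ b ∈ Tm Γ ρ ] (∀ {Θ} → Θ ⊢ a ≐ b)

root : (f : Tm Γ (ρ ⇒ η)) (a : Tm Γ ρ) → Reduct (f · a)
root (lam b) a = b [ a ] , β
root (con (Rec ρ) · a · f) (con O) = a , Rec-O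
root (con (Rec ρ) · a · f) (con Succ · m) = f · m · (con (Rec ρ) · a · f · m) , Rec-Succ
root (con len) (con nil) = con O , len-nil
root (con len) (con snoc · s · x) = con Succ · (con len · s) , len-snoc
-- The equations for `look` involve comparing an index with a length, so they are not contracted
-- here and are applied by hand.
root f a = f · a , ≐-refl

simp : (a : Tm Γ ρ) → Reduct a
simp (lam a) = lam (proj₁ (simp a)) , ≐-lam (proj₂ (simp a))
simp (f · a) = proj₁ r , ≐-trans (≐-app (proj₂ (simp f)) (proj₂ (simp a))) (proj₂ r)
  where r = root (proj₁ (simp f)) (proj₁ (simp a))
simp a = a , ≐-refl

simp^ : ℕ → (a : Tm Γ ρ) → Reduct a
simp^ zero a    = a , ≐-refl
simp^ (suc n) a = proj₁ r , ≐-trans (proj₂ (simp a)) (proj₂ r)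
  where r = simp^ n (proj₁ (simp a))

-- Proof by reflection: a simplified term carries a derivation that it equals the original, so it is
-- enough that `n` passes bring both sides to the same term, which `refl` checks. The number `n` is
-- only fuel.
compute : ∀ n {a b : Tm Γ ρ} → proj₁ (simp^ n a) ≡ proj₁ (simp^ n b) → Θ ⊢ a ≐ b
compute n {a} {b} e = ≐-trans (conv-r e (proj₂ (simp^ n a))) (≐-sym (proj₂ (simp^ n b)))

weaken : {Θ Θ' : List (Fm Γ)} {A : Fm Γ} → Θ ⊆ Θ' → Θ ⊢ A → Θ' ⊢ A
weaken {Θ' = Θ'} {A} i d = conv (subF-var A)
  (⊢-sub var (λ {B} x → subst (_∈ Θ') (sym (subF-var B)) (i x)) d)

-- Natural numbers

succ : Tm Γ N → Tm Γ N
succ a = con Succ · a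

infixl 24 _∸_
_∸_ : Tm Γ N → Tm Γ N → Tm Γ N
a ∸ b = monus · a · b

zero-or-Succ : Θ ⊢ ∀' N (v0 ≐ con O ∨ ∃' N (v1 ≐ succ v0))
zero-or-Succ = ind _ (∨I₁ ≐-refl) (∀I (⊃I (∨I₂ (∃I v0 ≐-refl))))

cases : {C : Fm Γ} (a : Tm Γ N) → a ≐ con O ∷ Θ ⊢ C →
        a ↑ ≐ succ v0 ∷ map _↑F Θ ⊢ C ↑F → Θ ⊢ C
cases a d e = ∨E (∀E zero-or-Succ a) d (∃E (hyp (here refl))
  (weaken (λ { (here p) → here p ; (there x) → there (there x) }) e))

ind-cases : (A : Pred Γ N) → Θ ⊢ A ⟨ con O ⟩ →
            map _↑F Θ ⊢ A ↑P ⟨ succ v0 ⟩ → Θ ⊢ ∀' N A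
ind-cases A d e = ind A d (∀I (⊃I (weaken there e)))

succ-cong : Θ ⊢ a ≐ b → Θ ⊢ succ a ≐ succ b
succ-cong = ≐-app ≐-refl

pred-cong : Θ ⊢ a ≐ b → Θ ⊢ pred · a ≐ pred · b
pred-cong = ≐-app ≐-refl

∸-cong : Θ ⊢ a ≐ a' → Θ ⊢ b ≐ b' → Θ ⊢ a ∸ b ≐ a' ∸ b'
∸-cong d e = ≐-app (≐-app ≐-refl d) e

pred-succ : Θ ⊢ pred · succ a ≐ a
pred-succ {a = a} = inst {A = pred · succ v0 ≐ v0} (compute 3 refl) (a ◂ var)

∸-O : Θ ⊢ a ∸ con O ≐ a
∸-O {a = a} = inst {A = v0 ∸ con O ≐ v0} (compute 5 refl) (a ◂ var)

∸-succ : Θ ⊢ a ∸ succ b ≐ pred · (a ∸ b)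
∸-succ {a = a} {b = b} =
  inst {A = v1 ∸ succ v0 ≐ pred · (v1 ∸ v0)} (compute 5 refl) (b ◂ (a ◂ var))

O-∸ : Θ ⊢ ∀' N (con O ∸ v0 ≐ con O)
O-∸ = ind _ (compute 5 refl) (∀I (⊃I
  (≐-trans ∸-succ (≐-trans (pred-cong (hyp (here refl))) (compute 3 refl)))))

∸-succ-succ : Θ ⊢ succ a ∸ succ b ≐ a ∸ b
∸-succ-succ {a = a} {b = b} = inst {A = succ v1 ∸ succ v0 ≐ v1 ∸ v0} (∀E ∀b v0) (b ◂ (a ◂ var))
  where
  ∀b : [] ⊢ ∀' N (succ v2 ∸ succ v0 ≐ v2 ∸ v0)
  ∀b = ind _ (compute 5 refl) (∀I (⊃I
    (≐-trans ∸-succ (≐-trans (pred-cong (hyp (here refl))) (≐-sym ∸-succ)))))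

-- A nonzero difference is not truncated, so the value one pins down `b`. Induction on `b`, for all
-- `a` at once, with a case split on `a`.
∸≐1 : Θ ⊢ succ a ∸ b ≐ succ (con O) → Θ ⊢ a ≐ b
∸≐1 {a = a} {b = b} d = ⊃E (inst {A = succ v1 ∸ v0 ≐ succ (con O) ⊃ v1 ≐ v0}
                              (∀E (∀E ∀ba v0) v1) (b ◂ (a ◂ var))) d
  where
  ∀ba : [] ⊢ ∀' N (∀' N (succ v0 ∸ v1 ≐ succ (con O) ⊃ v0 ≐ v1))
  ∀ba = ind _
    (∀I (⊃I (Succ-inj (≐-trans (compute 5 refl) (hyp (here refl))))))
    (∀I (⊃I (ind-cases _
      (⊃I (⊥E (Succ≢O (≐-trans (≐-sym (hyp (here refl)))
        (≐-trans ∸-succ-succ (∀E O-∸ v0))))))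
      (⊃I (succ-cong (⊃E (∀E (hyp (there (here refl))) v0)
        (≐-trans (≐-sym ∸-succ-succ) (hyp (here refl)))))))))

-- Turns the condition for continuing, |s| ≤ t(ŝ), into the successor form of m(s) that `Rec-Succ`
-- requires.
≼⇒succ∸ : Θ ⊢ b ≼ a → Θ ⊢ succ a ∸ b ≐ succ (a ∸ b)
≼⇒succ∸ {b = b} {a = a} d = ⊃E (inst {A = v0 ∸ v1 ≐ con O ⊃ succ v1 ∸ v0 ≐ succ (v1 ∸ v0)}
                              (∀E (∀E ∀ba v0) v1) (b ◂ (a ◂ var))) d
  where
  ∀ba : [] ⊢ ∀' N (∀' N (v1 ∸ v0 ≐ con O ⊃ succ v0 ∸ v1 ≐ succ (v0 ∸ v1)))
  ∀ba = ind _
    (∀I (⊃I (compute 5 refl)))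
    (∀I (⊃I (ind-cases _
      (⊃I (⊥E (Succ≢O {n = v0} (≐-trans (compute 5 refl) (hyp (here refl))))))
      (⊃I (≐-trans ∸-succ-succ (≐-trans
        (⊃E (∀E (hyp (there (here refl))) v0) (≐-trans (≐-sym ∸-succ-succ) (hyp (here refl))))
        (succ-cong (≐-sym ∸-succ-succ))))))))

-- Concatenation

single : Tm Γ τ → Tm Γ (τ *)
single x = con snoc · con nil · x

look-single : {x : Tm Γ τ} → Θ ⊢ con look · single x · con O ≐ x
look-single = ≐-trans (≐-app ≐-refl (≐-sym len-nil)) look-=

-- Monotonicity of a bar speaks of `append`, bar recursion of `snoc`; this joins the two.
append-single : {s : Tm Γ (τ *)} {x : Tm Γ τ} → Θ ⊢ append · s · single x ≐ con snoc · s · x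
append-single {τ = τ} {s = s} {x = x} = ≐-trans
  (inst {Γ = τ * ∷ τ ∷ []}
        {A = append · v0 · single v1 ≐ con snoc · v0 · (con look · single v1 · con O)}
        (compute 5 refl) (s ◂ (x ◂ λ ())))
  (≐-app ≐-refl look-single)

⁀-unfold : (s : Tm Γ (τ *)) (α : Tm Γ (N ⇒ τ)) (n : Tm Γ N) →
  Θ ⊢ (s ⁀ α) · n ≐ con (Rec τ) · (con look · s · n)
                      · lam (lam (α ↑ ↑ · (n ↑ ↑ ∸ con len · s ↑ ↑)))
                      · (succ n ∸ con len · s)
⁀-unfold {τ = τ} s α n = inst {Γ = τ * ∷ (N ⇒ τ) ∷ N ∷ []}
  {A = (v0 ⁀ v1) · v2 ≐ con (Rec τ) · (con look · v0 · v2)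
                      · lam (lam (v3 · (v4 ∸ con len · v2)))
                      · (succ v2 ∸ con len · v0)}
  (compute 6 refl) (s ◂ (α ◂ (n ◂ λ ())))

⁀-< : {s : Tm Γ (τ *)} {α : Tm Γ (N ⇒ τ)} {n : Tm Γ N} →
      Θ ⊢ n ≺ con len · s → Θ ⊢ (s ⁀ α) · n ≐ con look · s · n
⁀-< d = ≐-trans (⁀-unfold _ _ _) (≐-trans (≐-app ≐-refl d) Rec-O)

-- The premise is the positive form of |s| ≤ n: it fires `Rec-Succ`, and it is what `cases` supplies
-- for (n + 1) ∸ |s|.
⁀-≥ : {s : Tm Γ (τ *)} {α : Tm Γ (N ⇒ τ)} {n k : Tm Γ N} →
      Θ ⊢ succ n ∸ con len · s ≐ succ k → Θ ⊢ (s ⁀ α) · n ≐ α · (n ∸ con len · s)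
⁀-≥ {τ = τ} {s = s} {α} {n} {k} d = ≐-trans (⁀-unfold s α n) (≐-trans (≐-app ≐-refl d)
  -- The last variable stands for the previous value of the recursor, which the step function,
  -- constant in both arguments, discards.
  (≐-trans Rec-Succ (inst {Γ = τ * ∷ (N ⇒ τ) ∷ N ∷ N ∷ τ ∷ []}
    {A = lam (lam (v3 · (v4 ∸ con len · v2))) · v3 · var (there (there (there (there (here refl)))))
          ≐ v1 · (v2 ∸ con len · v0)}
    (compute 6 refl) (s ◂ (α ◂ (n ◂ (k ◂ (con (Rec τ) · (con look · s · n)
      · lam (lam (α ↑ ↑ · (n ↑ ↑ ∸ con len · s ↑ ↑))) · k ◂ λ ()))))))))

module _ {s : Tm Γ (τ *)} {x : Tm Γ τ} {γ : Tm Γ (N ⇒ τ)} {n : Tm Γ N} where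

  private
    Goal = (con snoc · s · x ⁀ γ) · n ≐ (s ⁀ (single x ⁀ γ)) · n

  succ∸snoc : ∀ {k} → Θ ⊢ succ n ∸ con len · s ≐ k →
           Θ ⊢ succ n ∸ con len · (con snoc · s · x) ≐ pred · k
  succ∸snoc d = ≐-trans (∸-cong ≐-refl len-snoc) (≐-trans ∸-succ (pred-cong d))

  ∸len : ∀ {k} → Θ ⊢ succ n ∸ con len · s ≐ succ k → Θ ⊢ n ∸ con len · s ≐ k
  ∸len d = ≐-trans (≐-sym ∸-succ-succ) (≐-trans ∸-succ (≐-trans (pred-cong d) pred-succ))

  ⁀-snoc-< : Θ ⊢ n ≺ con len · s → Θ ⊢ Goal
  ⁀-snoc-< d = ≐-trans (⁀-< (≐-trans (succ∸snoc d) (compute 3 refl)))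
                 (≐-trans (look-< d) (≐-sym (⁀-< d)))

  ⁀-snoc-= : Θ ⊢ succ n ∸ con len · s ≐ succ (con O) → Θ ⊢ Goal
  ⁀-snoc-= d = ≐-trans
    (≐-trans (⁀-< (≐-trans (succ∸snoc d) pred-succ))
      -- The value one means n = |s|, the position of the new element.
      (≐-trans (≐-app ≐-refl (∸≐1 d)) look-=))
    -- On the other side the offset n ∸ |s| is zero, which falls inside the one-element sequence.
    (≐-sym (≐-trans (⁀-≥ d) (≐-trans (≐-app ≐-refl (∸len d))
      (≐-trans (⁀-< (≐-trans (∸-cong ≐-refl (≐-trans len-snoc (succ-cong len-nil))) (compute 5 refl)))
        look-single))))

  ∸single : ∀ {a} → Θ ⊢ a ∸ con len · single x ≐ pred · a
  ∸single = ≐-trans (∸-cong ≐-refl (≐-trans len-snoc (succ-cong len-nil)))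
              (≐-trans ∸-succ (pred-cong ∸-O))

  -- Both sides are the value of `γ` at `k`, one place being taken up by `x`.
  ⁀-snoc-> : ∀ {k} → Θ ⊢ succ n ∸ con len · s ≐ succ (succ k) → Θ ⊢ Goal
  ⁀-snoc-> {k = k} d = ≐-trans
    (≐-trans (⁀-≥ (≐-trans (succ∸snoc d) pred-succ))
      (≐-app ≐-refl (≐-trans (∸-cong ≐-refl len-snoc) (≐-trans ∸-succ
        (≐-trans (pred-cong (∸len d)) pred-succ)))))
    (≐-sym (≐-trans (⁀-≥ d) (≐-trans (≐-app ≐-refl (∸len d))
      (≐-trans (⁀-≥ (≐-trans ∸single pred-succ)) (≐-app ≐-refl (≐-trans ∸single pred-succ))))))

-- The number (n + 1) ∸ |s| separates the positions: zero, one and at least two mean n < |s|, n =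
-- |s| and n > |s|.
⁀-snoc-at : {s : Tm Γ (τ *)} {x : Tm Γ τ} {γ : Tm Γ (N ⇒ τ)} {n : Tm Γ N} →
            Θ ⊢ (con snoc · s · x ⁀ γ) · n ≐ (s ⁀ (single x ⁀ γ)) · n
⁀-snoc-at {s = s} {n = n} = cases (succ n ∸ con len · s)
  (⁀-snoc-< (hyp (here refl)))
  (cases v0
    (⁀-snoc-= (≐-trans (hyp (there (here refl))) (succ-cong (hyp (here refl)))))
    (⁀-snoc-> (≐-trans (hyp (there (here refl))) (succ-cong (hyp (here refl))))))

-- This presents an infinite extension of s * x as an extension of s, to which security at s
-- applies.
⁀-snoc : {s : Tm Γ (τ *)} {x : Tm Γ τ} {γ : Tm Γ (N ⇒ τ)} →
         Θ ⊢ con snoc · s · x ⁀ γ ≐ s ⁀ (single x ⁀ γ)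
⁀-snoc = ≐-ext (∀I ⁀-snoc-at)

-- Bar recursion

v5 : ∀ {ρ₀ ρ₁ ρ₂ ρ₃ ρ₄ ρ₅} → Tm (ρ₀ ∷ ρ₁ ∷ ρ₂ ∷ ρ₃ ∷ ρ₄ ∷ ρ₅ ∷ Γ) ρ₅
v5 = v4 ↑

v6 : ∀ {ρ₀ ρ₁ ρ₂ ρ₃ ρ₄ ρ₅ ρ₆} → Tm (ρ₀ ∷ ρ₁ ∷ ρ₂ ∷ ρ₃ ∷ ρ₄ ∷ ρ₅ ∷ ρ₆ ∷ Γ) ρ₆
v6 = v5 ↑

-- This is m(s). The zero sequence and t are parameters `z` and `Y`, so that variables can stand for
-- them: `zeroObj τ` and `closed t` are stuck for unknown `τ` and `t`, and substitution would not
-- compute through them.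
remaining : Tm Γ (N ⇒ τ) → Tm Γ ((N ⇒ τ) ⇒ N) → Tm Γ (τ *) → Tm Γ N
remaining z Y s = succ (Y · (s ⁀ z)) ∸ con len · s

unroll : Tm Γ (τ * ⇒ (τ ⇒ σ) ⇒ σ) → Tm Γ (N ⇒ (τ * ⇒ σ) ⇒ τ * ⇒ σ)
unroll H = lam (lam (lam (H ↑ ↑ ↑ · v0 · lam (v2 · (con snoc · v1 · v0)))))

-- This is G'. Its recursor is at type τ* → σ, whose level is exactly max{1 + level(τ), level(σ)};
-- this accounts for the bound i.
secured : Tm Γ (N ⇒ τ) → Tm Γ ((N ⇒ τ) ⇒ N) →
          Tm Γ (τ * ⇒ σ) → Tm Γ (τ * ⇒ (τ ⇒ σ) ⇒ σ) → Tm Γ (τ * ⇒ σ)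
secured z Y G H = lam (con (Rec _) · G ↑ · unroll (H ↑) · remaining (z ↑) (Y ↑) v0 · v0)

-- This is H'. The recursor at σ, with a constant step function, serves as the case distinction on
-- m(s).
unsecured : Tm Γ (N ⇒ τ) → Tm Γ ((N ⇒ τ) ⇒ N) →
            Tm Γ (τ * ⇒ σ) → Tm Γ (τ * ⇒ (τ ⇒ σ) ⇒ σ) → Tm Γ (τ * ⇒ (τ ⇒ σ) ⇒ σ)
unsecured z Y G H = lam (lam (con (Rec _) · (G ↑ ↑ · v1) · lam (lam (H ↑ ↑ ↑ ↑ · v3 · v2))
                                · remaining (z ↑ ↑) (Y ↑ ↑) v1))

spector : ∀ σ → Tm Γ (N ⇒ τ) → Tm Γ ((N ⇒ τ) ⇒ N) → Tm Γ (BRTy τ σ ⇒ BRTy τ σ)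
spector σ z Y = lam (lam (lam (lam
  (v3 · secured (z ↑ ↑ ↑ ↑) (Y ↑ ↑ ↑ ↑) v2 v1 · unsecured (z ↑ ↑ ↑ ↑) (Y ↑ ↑ ↑ ↑) v2 v1 · v0))))

module _ {z : Tm Γ (N ⇒ τ)} {Y : Tm Γ ((N ⇒ τ) ⇒ N)}
         {G : Tm Γ (τ * ⇒ σ)} {H : Tm Γ (τ * ⇒ (τ ⇒ σ) ⇒ σ)} where

  spector-β : {D : Tm Γ (BRTy τ σ)} {s : Tm Γ (τ *)} →
    Θ ⊢ spector σ z Y · D · G · H · s ≐ D · secured z Y G H · unsecured z Y G H · s
  spector-β {D = D} {s} = inst
    {Γ = τ * ∷ (τ * ⇒ (τ ⇒ σ) ⇒ σ) ∷ (τ * ⇒ σ) ∷ BRTy τ σ ∷ (N ⇒ τ) ∷ ((N ⇒ τ) ⇒ N) ∷ []}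
    {A = spector σ v4 v5 · v3 · v2 · v1 · v0 ≐ v3 · secured v4 v5 v2 v1 · unsecured v4 v5 v2 v1 · v0}
    (compute 10 refl) (s ◂ (H ◂ (G ◂ (D ◂ (z ◂ (Y ◂ λ ()))))))

  secured-β : {s : Tm Γ (τ *)} →
    Θ ⊢ secured z Y G H · s ≐ con (Rec _) · G · unroll H · remaining z Y s · s
  secured-β {s = s} = inst
    {Γ = τ * ∷ (τ * ⇒ (τ ⇒ σ) ⇒ σ) ∷ (τ * ⇒ σ) ∷ (N ⇒ τ) ∷ ((N ⇒ τ) ⇒ N) ∷ []}
    {A = secured v3 v4 v2 v1 · v0 ≐ con (Rec _) · v2 · unroll v1 · remaining v3 v4 v0 · v0}
    (compute 10 refl) (s ◂ (H ◂ (G ◂ (z ◂ (Y ◂ λ ())))))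

  unroll-β : {n : Tm Γ N} {f : Tm Γ (τ * ⇒ σ)} {s : Tm Γ (τ *)} →
    Θ ⊢ unroll H · n · f · s ≐ H · s · lam (f ↑ · (con snoc · s ↑ · v0))
  unroll-β {n = n} {f} {s} = inst
    {Γ = τ * ∷ (τ * ⇒ (τ ⇒ σ) ⇒ σ) ∷ (τ * ⇒ σ) ∷ N ∷ []}
    {A = unroll v1 · v3 · v2 · v0 ≐ v1 · v0 · lam (v3 · (con snoc · v1 · v0))}
    (compute 5 refl) (s ◂ (H ◂ (f ◂ (n ◂ λ ()))))

  unsecured-β : {s : Tm Γ (τ *)} {f : Tm Γ (τ ⇒ σ)} →
    Θ ⊢ unsecured z Y G H · s · f
      ≐ con (Rec _) · (G · s) · lam (lam (H ↑ ↑ · s ↑ ↑ · f ↑ ↑)) · remaining z Y s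
  unsecured-β {s = s} {f} = inst
    {Γ = τ * ∷ (τ * ⇒ (τ ⇒ σ) ⇒ σ) ∷ (τ * ⇒ σ) ∷ (τ ⇒ σ) ∷ (N ⇒ τ) ∷ ((N ⇒ τ) ⇒ N) ∷ []}
    {A = unsecured v4 v5 v2 v1 · v0 · v3
           ≐ con (Rec _) · (v2 · v0) · lam (lam (v3 · v2 · v5)) · remaining v4 v5 v0}
    (compute 10 refl) (s ◂ (H ◂ (G ◂ (f ◂ (z ◂ (Y ◂ λ ()))))))

  secured-stop : {s : Tm Γ (τ *)} → Θ ⊢ remaining z Y s ≐ con O →
                 Θ ⊢ secured z Y G H · s ≐ G · s
  secured-stop d = ≐-trans secured-β (≐-app (≐-trans (≐-app ≐-refl d) Rec-O) ≐-refl)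

  secured-go : {s : Tm Γ (τ *)} {k : Tm Γ N} → Θ ⊢ remaining z Y s ≐ succ k →
    Θ ⊢ secured z Y G H · s
      ≐ H · s · lam ((con (Rec _) · G · unroll H · k) ↑ · (con snoc · s ↑ · v0))
  secured-go d = ≐-trans secured-β (≐-trans
    (≐-app (≐-trans (≐-app ≐-refl d) Rec-Succ) ≐-refl) unroll-β)

  unsecured-stop : {s : Tm Γ (τ *)} {f : Tm Γ (τ ⇒ σ)} → Θ ⊢ remaining z Y s ≐ con O →
                   Θ ⊢ unsecured z Y G H · s · f ≐ G · s
  unsecured-stop d = ≐-trans unsecured-β (≐-trans (≐-app ≐-refl d) Rec-O)

  unsecured-go : {s : Tm Γ (τ *)} {f : Tm Γ (τ ⇒ σ)} {k : Tm Γ N} →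
                 Θ ⊢ remaining z Y s ≐ succ k → Θ ⊢ unsecured z Y G H · s · f ≐ H · s · f
  unsecured-go {s = s} {f} {k} d = ≐-trans unsecured-β (≐-trans (≐-app ≐-refl d)
    (≐-trans Rec-Succ (inst {Γ = σ ∷ σ ∷ N ∷ []} {A = lam (lam v2) · v2 · v1 ≐ v0}
      (compute 3 refl) (H · s · f ◂
        (con (Rec _) · (G · s) · lam (lam (H ↑ ↑ · s ↑ ↑ · f ↑ ↑)) · k ◂ (k ◂ λ ()))))))

  -- With the value of `Y` unchanged, m(s * x) = (Y + 1) ∸ (|s| + 1) = Y ∸ |s|. This is the number
  -- of steps left after the one taken at s, so the rest of the recursion that `secured-go` exposes
  -- is G'(s * x).
  secured-snoc : {s : Tm Γ (τ *)} {x : Tm Γ τ} →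
    Θ ⊢ Y · (con snoc · s · x ⁀ z) ≐ Y · (s ⁀ z) →
    Θ ⊢ secured z Y G H · (con snoc · s · x)
      ≐ con (Rec _) · G · unroll H · (Y · (s ⁀ z) ∸ con len · s) · (con snoc · s · x)
  secured-snoc d = ≐-trans secured-β (≐-app (≐-app ≐-refl
    (≐-trans (∸-cong (succ-cong d) len-snoc) ∸-succ-succ)) ≐-refl)

Vars : Ty → Ty → Ctx
Vars τ σ = BRTy τ σ ∷ (N ⇒ τ) ∷ ((N ⇒ τ) ⇒ N) ∷ []

-- All that is used of S.  The variables are Δ, the zero sequence and Y; in the first
-- alternative S(s) holds, in the second it fails.
Split : ∀ τ σ → Fm (Vars τ σ)
Split τ σ = ∀' (τ * ⇒ σ) (∀' (τ * ⇒ (τ ⇒ σ) ⇒ σ) (∀' (τ *)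
  ( v3 · v2 · v1 · v0 ≐ v2 · v0
    ∧ ∀' τ (v4 · v3 · v2 · (con snoc · v1 · v0) ≐ v3 · (con snoc · v1 · v0)
            ∧ v6 · (con snoc · v1 · v0 ⁀ v5) ≐ v6 · (v1 ⁀ v5))
  ∨ v3 · v2 · v1 · v0 ≐ v1 · v0 · lam (v4 · v3 · v2 · (con snoc · v1 · v0)))))

-- `BR` with variables for the zero sequence and t. The two conditions have s as an extra variable,
-- so these are `v2` and `v3` there, but `v1` and `v2` in the functional.
Spector : ∀ τ σ → Fm (Vars τ σ)
Spector τ σ = BarRec (v3 · (v0 ⁀ v2) ≺ con len · v0) (con len · v0 ≼ v3 · (v0 ⁀ v2))
                     (spector σ v1 v2 · v0)

Split⊃Spector : [] ⊢ Split τ σ ⊃ Spector τ σ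
Split⊃Spector = ⊃I (∀I (∀I (∀I
  -- Spector's functional is Δ(G', H'), so the alternatives are taken at G', H' and the given s.
  (∨E (∀E (∀E (∀E (hyp (here refl)) (secured v4 v5 v2 v1)) (unsecured v4 v5 v2 v1)) v0)
  (∧I
    (⊃I (≐-trans spector-β (≐-trans (∧E₁ (hyp (there (here refl))))
      (secured-stop (hyp (here refl))))))
    (⊃I (≐-trans spector-β (≐-trans (∧E₁ (hyp (there (here refl)))) (≐-trans
      (secured-go (≼⇒succ∸ (hyp (here refl))))
      -- Under the abstraction, the functional at s * x is G'(s * x) by the second half of the
      -- alternative, and this is the recursor with one step fewer.
      (≐-app ≐-refl (≐-lam (≐-sym (≐-trans spector-β (≐-trans
        (∧E₁ (∀E (∧E₂ (hyp (there (here refl)))) v0))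
        (secured-snoc (∧E₂ (∀E (∧E₂ (hyp (there (here refl)))) v0)))))))))))))
  -- Here Δ makes one step with H', whose case distinction on m(s) yields both equations.
  (∧I
    (⊃I (≐-trans spector-β (≐-trans (hyp (there (here refl)))
      (unsecured-stop (hyp (here refl))))))
    (⊃I (≐-trans spector-β (≐-trans (hyp (there (here refl))) (≐-trans
      (unsecured-go (≼⇒succ∸ (hyp (here refl))))
      (≐-app ≐-refl (≐-lam (≐-sym spector-β))))))))))))

-- Instances of the bar

-- Formulas are kept as one simultaneous substitution `subF s A` instead of nested shifts and
-- instances, so that for an unknown predicate only `s` changes. This is weakening by a variable in
-- that form; `∀E-sub` is instantiation.
⊢-↑ : {A : Fm Γ} (s : Sub Γ Δ) → Θ ⊢ subF s A →
      map (_↑F {ρ = η}) Θ ⊢ subF (λ x → s x ↑) A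
⊢-↑ {Θ = Θ} {A = A} s d =
  conv (trans (sym (renF≡subF there (subF s A))) (renF-subF there s A))
    (⊢-sub (λ x → var (there x))
      (λ {B} x → subst (_∈ map _↑F Θ) (renF≡subF there B) (∈-map⁺ _↑F x)) d)

⟨⟩-sub : (s : Sub Γ Δ) (P : Pred Γ ρ) (a : Tm Γ ρ) → subF s (P ⟨ a ⟩) ≡ subF (sub s a ◂ s) P
⟨⟩-sub s P a = trans (subF-subF s _ P)
  (subF-cong (λ { (here refl) → refl ; (there x) → refl }) P)

↑P-sub : (s : Sub (η ∷ Γ) Δ) (P : Pred Γ ρ) (a : Tm Δ ρ) →
         subF (a ◂ s) (P ↑P) ≡ subF (a ◂ (λ x → s (there x))) P
↑P-sub s P a = trans (subF-renF _ (lift there) P)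
  (subF-cong (λ { (here refl) → refl ; (there x) → refl }) P)

↑P-exts : (s : Sub Γ Δ) (P : Pred Γ ρ) →
          subF (exts (exts {ρ = η} s)) (P ↑P) ≡ subF (exts s) P ↑P
↑P-exts s P = trans (subF-renF _ (lift there) P) (trans
  (subF-cong (λ { (here refl) → refl ; (there x) → sym (ren-↑ there (s x)) }) P)
  (sym (renF-subF (lift there) (exts s) P)))

∀E-sub : (A : Fm (ρ ∷ Γ)) (s : Sub Γ Δ) → Θ ⊢ subF s (∀' ρ A) →
         (a : Tm Δ ρ) → Θ ⊢ subF (a ◂ s) A
∀E-sub A s d a = conv
  (trans (subF-subF _ (exts s) A)
    (subF-cong (λ { (here refl) → refl ; (there x) → ↑-inst a (s x) }) A))
  (∀E d a)

module _ {P : Pred Γ (τ *)} (s : Sub Γ Δ) where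

  Bar-dec : Θ ⊢ subF s (Bar P) → (a : Tm Δ (τ *)) →
            Θ ⊢ subF (a ◂ s) P ∨ ¬' (subF (a ◂ s) P)
  Bar-dec d a = conv (cong (λ A → A ∨ ¬' A)
      (trans (⟨⟩-sub (a ◂ s) (P ↑P) v0) (↑P-sub (a ◂ s) P a)))
    (∀E-sub (P ↑P ⟨ v0 ⟩ ∨ ¬' (P ↑P ⟨ v0 ⟩)) s (∧E₁ d) a)

  -- Monotonicity is used with a one-element sequence and carried along `append-single`; `P'` is `P`
  -- as a predicate over `Δ`, the form that `≐-subst` asks for.
  Bar-snoc : Θ ⊢ subF s (Bar P) → {a : Tm Δ (τ *)} {x : Tm Δ τ} →
             Θ ⊢ subF (a ◂ s) P → Θ ⊢ subF (con snoc · a · x ◂ s) P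
  Bar-snoc d {a} {x} e =
    conv (P'-at _) (≐-subst P' append-single (conv (sym (P'-at _))
        (conv (at (append · v1 · v0))
          (⊃E (∀E-sub A (a ◂ s) (∀E-sub (∀' _ A) s (∧E₂ (∧E₂ d)) a) (single x))
            (conv (sym (at v1)) e)))))
    where
    A = P ↑P ↑P ⟨ v1 ⟩ ⊃ P ↑P ↑P ⟨ append · v1 · v0 ⟩
    s' : Sub (τ * ∷ τ * ∷ Γ) Δ
    s' = single x ◂ (a ◂ s)
    at : (b : Tm (τ * ∷ τ * ∷ Γ) (τ *)) → subF s' (P ↑P ↑P ⟨ b ⟩) ≡ subF (sub s' b ◂ s) P
    at b = trans (⟨⟩-sub s' (P ↑P ↑P) b)
             (trans (↑P-sub s' (P ↑P) (sub s' b)) (↑P-sub (a ◂ s) P (sub s' b)))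
    P' : Pred Δ (τ *)
    P' = subF (exts s) P
    P'-at : (b : Tm Δ (τ *)) → subF (b ◂ var) P' ≡ subF (b ◂ s) P
    P'-at b = trans (subF-subF _ (exts s) P)
      (subF-cong (λ { (here refl) → refl ; (there x) → ↑-inst b (s x) }) P)

  Secures-const : {Y : Tm Γ ((N ⇒ τ) ⇒ N)} → Θ ⊢ subF s (Secures P Y) →
                  {a : Tm Δ (τ *)} {α γ : Tm Δ (N ⇒ τ)} → Θ ⊢ subF (a ◂ s) P →
                  Θ ⊢ sub s Y · (a ⁀ α) ≐ sub s Y · (a ⁀ γ)
  Secures-const {Y = Y} d {a} {α} {γ} e =
    conv (cong (λ Z → Z · (a ⁀ α) ≐ Z · (a ⁀ γ))
        (trans (sub-ren (γ ◂ (α ◂ (a ◂ s))) there (Y ↑ ↑))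
          (trans (sub-ren (α ◂ (a ◂ s)) there (Y ↑)) (sub-ren (a ◂ s) there Y))))
      (∀E-sub A (α ◂ (a ◂ s)) (∀E-sub (∀' _ A) (a ◂ s)
        (⊃E (∀E-sub (P ↑P ⟨ v0 ⟩ ⊃ ∀' _ (∀' _ A)) s d a)
          (conv (sym (trans (⟨⟩-sub (a ◂ s) (P ↑P) v0) (↑P-sub (a ◂ s) P a))) e)) α) γ)
    where
    A = Y ↑ ↑ ↑ · (v2 ⁀ v1) ≐ Y ↑ ↑ ↑ · (v2 ⁀ v0)

GBR-at : {P : Pred Γ (τ *)} (s : Sub (BRTy τ σ ∷ Γ) Δ) → Θ ⊢ subF s (GBR (P ↑P) v0) →
  {G : Tm Δ (τ * ⇒ σ)} {H : Tm Δ (τ * ⇒ (τ ⇒ σ) ⇒ σ)} {a : Tm Δ (τ *)} →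
  let D = s (here refl)
      A = subF (a ◂ (λ x → s (there x))) P in
  Θ ⊢ (A ⊃ D · G · H · a ≐ G · a)
    ∧ (¬' A ⊃ D · G · H · a ≐ H · a · lam (D ↑ · G ↑ · H ↑ · (con snoc · a ↑ · v0)))
GBR-at {P = P} s d {G} {H} {a} = conv
  (cong (λ A → (A ⊃ s (here refl) · G · H · a ≐ G · a)
     ∧ (¬' A ⊃ s (here refl) · G · H · a
                 ≐ H · a · lam (s (here refl) ↑ · G ↑ · H ↑ · (con snoc · a ↑ · v0))))
    (trans (⟨⟩-sub (a ◂ (H ◂ (G ◂ s))) (P ↑P ↑P ↑P ↑P) v0)
      (trans (↑P-sub (a ◂ (H ◂ (G ◂ s))) (P ↑P ↑P ↑P) a)
      (trans (↑P-sub (H ◂ (G ◂ s)) (P ↑P ↑P) a)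
        (trans (↑P-sub (G ◂ s) (P ↑P) a) (↑P-sub s P a))))))
  (∀E-sub A (H ◂ (G ◂ s)) (∀E-sub (∀' _ A) (G ◂ s) (∀E-sub (∀' _ (∀' _ A)) s d G) H) a)
  where
  A = (P ↑P ↑P ↑P ↑P ⟨ v0 ⟩ ⊃ v3 · v2 · v1 · v0 ≐ v2 · v0)
    ∧ (¬' (P ↑P ↑P ↑P ↑P ⟨ v0 ⟩)
        ⊃ v3 · v2 · v1 · v0 ≐ v1 · v0 · lam (v4 · v3 · v2 · (con snoc · v1 · v0)))

BarRec-sub : (s : Sub Γ Δ) (P Q : Pred Γ (τ *)) (ξ : Tm Γ (BRTy τ σ)) →
  subF s (BarRec P Q ξ) ≡ BarRec (subF (exts s) P) (subF (exts s) Q) (sub s ξ)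
BarRec-sub {Γ} {Δ} {τ} {σ} s P Q ξ = cong (λ A → ∀' _ (∀' _ (∀' _ A)))
  (cong₂ _∧_
    (cong₂ _⊃_ (pred-at P) (cong (λ f → f · v2 · v1 · v0 ≐ v2 · v0) (↑↑↑ ξ)))
    (cong₂ _⊃_ (pred-at Q) (cong₂
      (λ f g → f · v2 · v1 · v0 ≐ v1 · v0 · lam (g · v3 · v2 · (con snoc · v1 · v0)))
      (↑↑↑ ξ) (trans (sub-↑ _ (ξ ↑ ↑ ↑)) (cong _↑ (↑↑↑ ξ))))))
  where
  ↑↑↑ : ∀ {ρ₀ ρ₁ ρ₂ ρ} (a : Tm Γ ρ) →
        sub (exts {ρ = ρ₀} (exts {ρ = ρ₁} (exts {ρ = ρ₂} s))) (a ↑ ↑ ↑) ≡ sub s a ↑ ↑ ↑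
  ↑↑↑ a = trans (sub-↑ _ (a ↑ ↑)) (cong _↑ (trans (sub-↑ _ (a ↑)) (cong _↑ (sub-↑ s a))))
  pred-at : ∀ {ρ₁ ρ₂} (P : Pred Γ (τ *)) →
    subF (exts {ρ = τ *} (exts {ρ = ρ₁} (exts {ρ = ρ₂} s))) (P ↑P ↑P ↑P ⟨ v0 ⟩)
      ≡ subF (exts s) P ↑P ↑P ↑P ⟨ v0 ⟩
  pred-at P = trans (subF-⟨⟩ _ (P ↑P ↑P ↑P) v0) (cong (_⟨ v0 ⟩)
    (trans (↑P-exts _ (P ↑P ↑P)) (cong _↑P (trans (↑P-exts _ (P ↑P)) (cong _↑P (↑P-exts s P))))))

-- The alternatives come from decidability of S at s. If S(s), monotonicity gives S(s * x), so
-- general bar recursion returns its first argument at both sequences, and security makes the values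
-- of Y agree. `Y'` is given up to an equation because a shifted closed term is not literally a
-- substituted one.
split : {P : Pred Γ (τ *)} {Y : Tm Γ ((N ⇒ τ) ⇒ N)} (s : Sub (BRTy τ σ ∷ Γ) Δ) →
  let s⁻ : Sub Γ Δ
      s⁻ x = s (there x) in
  Θ ⊢ subF s⁻ (Bar P ∧ Secures P Y) → Θ ⊢ subF s (GBR (P ↑P) v0) →
  {G : Tm Δ (τ * ⇒ σ)} {H : Tm Δ (τ * ⇒ (τ ⇒ σ) ⇒ σ)} {a : Tm Δ (τ *)} {z : Tm Δ (N ⇒ τ)}
  {Y' : Tm Δ ((N ⇒ τ) ⇒ N)} → sub s⁻ Y ≡ Y' →
  let D = s (here refl) in
  Θ ⊢ D · G · H · a ≐ G · a
      ∧ ∀' τ (D ↑ · G ↑ · H ↑ · (con snoc · a ↑ · v0) ≐ G ↑ · (con snoc · a ↑ · v0)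
              ∧ Y' ↑ · (con snoc · a ↑ · v0 ⁀ z ↑) ≐ Y' ↑ · (a ↑ ⁀ z ↑))
    ∨ D · G · H · a ≐ H · a · lam (D ↑ · G ↑ · H ↑ · (con snoc · a ↑ · v0))
split {Γ = Γ} {τ} {Δ = Δ} {Θ = Θ} {P = P} {Y} s d e {a = a} refl = ∨E (Bar-dec {P = P} s⁻ (∧E₁ d) a)
  (∨I₁ (∧I
    (⊃E (∧E₁ (GBR-at {P = P} s (weaken there e))) (hyp (here refl)))
    (∀I (∧I
      (⊃E (∧E₁ (GBR-at {P = P} s↑ (⊢-↑ {A = GBR (P ↑P) v0} s (weaken there e))))
        (Bar-snoc {P = P} s⁻↑ (∧E₁ d↑) secured-a))
      (conv (cong (λ Z → Z · _ ≐ Z · _) (sym (ren-sub there s⁻ Y)))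
        -- The sequence s * x followed by `z` is s followed by x and then `z`; security at s
        -- compares it with s followed by `z`.
        (≐-trans (≐-app ≐-refl ⁀-snoc) (Secures-const {P = P} s⁻↑ {Y = Y} (∧E₂ d↑) secured-a)))))))
  (∨I₂ (⊃E (∧E₂ (GBR-at {P = P} s (weaken there e))) (hyp (here refl))))
  where
  s⁻ : Sub Γ Δ
  s⁻ x = s (there x)
  s↑ : Sub (BRTy _ _ ∷ Γ) (τ ∷ Δ)
  s↑ x = s x ↑
  s⁻↑ : Sub Γ (τ ∷ Δ)
  s⁻↑ x = s⁻ x ↑
  d↑ : map _↑F (subF (a ◂ s⁻) P ∷ Θ) ⊢ subF s⁻↑ (Bar P ∧ Secures P Y)
  d↑ = ⊢-↑ {A = Bar P ∧ Secures P Y} s⁻ (weaken there d)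
  secured-a : map _↑F (subF (a ◂ s⁻) P ∷ Θ) ⊢ subF (a ↑ ◂ s⁻↑) P
  secured-a = conv (subF-cong (λ { (here refl) → refl ; (there x) → refl }) P)
    (⊢-↑ {A = P} (a ◂ s⁻) (hyp (here refl)))

-- Passage from variables to the closed term t

sub-closed : (s : Sub Γ Δ) (t : Tm [] ρ) → sub s (closed t) ≡ closed t
sub-closed s t = trans (sub-ren s _ t) (trans (sub-cong (λ ()) t) (sym (ren≡sub _ t)))

↑-closed : (t : Tm [] ρ) → _↑ {η = η} (closed {Γ} t) ≡ closed t
↑-closed t = trans (ren≡sub there (closed t)) (sub-closed _ t)

zeros : Tm Γ (N ⇒ τ)
zeros = lam (zeroObj _)

ren-zeros : (r : Γ ⊆ Δ) → ren r (zeros {τ = τ}) ≡ zeros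
ren-zeros {τ = τ} r = cong lam (trans (ren≡sub (lift r) (zeroObj τ)) (sub-zeroObj _ τ))

-- The term is by computation a substitution instance of itself at variables, so the renaming passes
-- through `ren-sub` and not through the body.
ren-spector : (r : Γ ⊆ Δ) (z : Tm Γ (N ⇒ τ)) (Y : Tm Γ ((N ⇒ τ) ⇒ N)) →
              ren r (spector σ z Y) ≡ spector σ (ren r z) (ren r Y)
ren-spector {Γ} {Δ} {τ} {σ} r z Y = trans
  (ren-sub r (z ◂ (Y ◂ var)) Φ)
  (sub-cong {s = λ x → ren r ((z ◂ (Y ◂ var)) x)} {s' = ren r z ◂ (ren r Y ◂ λ x → var (r x))}
    (λ { (here refl) → refl ; (there (here refl)) → refl ; (there (there x)) → refl }) Φ)
  where
  Φ : Tm ((N ⇒ τ) ∷ ((N ⇒ τ) ⇒ N) ∷ Γ) (BRTy τ σ ⇒ BRTy τ σ)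
  Φ = spector σ v0 v1

-- After `BarRec-sub` the two sides differ only in a shifted zero sequence and in the renamed
-- `spector` term; all else agrees by computation.
BR-spector : (t : Tm [] ((N ⇒ τ) ⇒ N)) →
  subF {Δ = BRTy τ σ ∷ Γ} (v0 ◂ (zeros ◂ (closed t ◂ λ ()))) (Spector τ σ)
    ≡ BR (closed (spector σ zeros t) · v0) (closed t)
BR-spector {τ} {σ} {Γ} t = trans
  (BarRec-sub {Γ = Vars τ σ} (v0 ◂ (zeros ◂ (closed t ◂ λ ())))
    (v3 · (v0 ⁀ v2) ≺ con len · v0) (con len · v0 ≼ v3 · (v0 ⁀ v2)) (spector σ v1 v2 · v0))
  (cong₂ body (ren-zeros there)
    (sym (trans (ren-spector _ zeros t) (cong (λ z → spector σ z (closed t)) (ren-zeros _)))))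
  where
  body : Tm (τ * ∷ BRTy τ σ ∷ Γ) (N ⇒ τ) → Tm (BRTy τ σ ∷ Γ) (BRTy τ σ ⇒ BRTy τ σ) →
         Fm (BRTy τ σ ∷ Γ)
  body z Φ = BarRec (closed t ↑ · (v0 ⁀ z) ≺ con len · v0)
                    (con len · v0 ≼ closed t ↑ · (v0 ⁀ z)) (Φ · v0)

-- Membership in T_i

ren-∈T : ∀ {i} (r : Γ ⊆ Δ) (a : Tm Γ ρ) → a ∈T i → ren r a ∈T i
ren-∈T r (var x) p = p
ren-∈T r (lam a) p = ren-∈T (lift r) a p
ren-∈T r (a · b) (p , q) = ren-∈T r a p , ren-∈T r b q
ren-∈T r (con (Rec ρ)) p = p
ren-∈T r (con O) p = p
ren-∈T r (con Succ) p = p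
ren-∈T r (con nil) p = p
ren-∈T r (con snoc) p = p
ren-∈T r (con len) p = p
ren-∈T r (con look) p = p

zeroObj-∈T : ∀ {i} ρ → zeroObj {Γ} ρ ∈T i
zeroObj-∈T N       = tt
zeroObj-∈T (ρ ⇒ η) = zeroObj-∈T η
zeroObj-∈T (ρ *)   = tt

monus-∈T : ∀ {i} → monus {Γ} ∈T i
monus-∈T = ((z≤n , tt) , (((z≤n , tt) , tt) , tt) , tt) , tt

prepend-∈T : ∀ {i} → level τ ≤ i → prepend {Γ} {τ} ∈T i
prepend-∈T {τ = τ} {Γ} {i} p =
  ((p , (tt , tt) , tt) , tt , (monus-∈T {τ ∷ N ∷ N ∷ (N ⇒ τ) ∷ τ * ∷ Γ} , tt) , tt , tt)
  , (monus-∈T {N ∷ (N ⇒ τ) ∷ τ * ∷ Γ} , tt , tt) , tt , tt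

↑-∈T : ∀ {i} (a : Tm Γ ρ) → a ∈T i → _↑ {η = η} a ∈T i
↑-∈T = ren-∈T there

remaining-∈T : ∀ {i} (z : Tm Γ (N ⇒ τ)) (Y : Tm Γ ((N ⇒ τ) ⇒ N)) (s : Tm Γ (τ *)) →
               level τ ≤ i → z ∈T i → Y ∈T i → s ∈T i → remaining z Y s ∈T i
remaining-∈T {Γ} {τ} z Y s h z∈ Y∈ s∈ =
  (monus-∈T {Γ} , tt , Y∈ , (prepend-∈T {τ} {Γ} h , s∈) , z∈) , tt , s∈

module _ {i : ℕ} (h : level (τ * ⇒ σ) ≤ i) (z : Tm Γ (N ⇒ τ)) (Y : Tm Γ ((N ⇒ τ) ⇒ N))
         (z∈ : z ∈T i) (Y∈ : Y ∈T i) where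

  private
    τ≤i : level τ ≤ i
    τ≤i = ≤-trans (n≤1+n _) (≤-trans (m≤m⊔n _ (level σ)) h)

  module _ (G : Tm Γ (τ * ⇒ σ)) (H : Tm Γ (τ * ⇒ (τ ⇒ σ) ⇒ σ)) (G∈ : G ∈T i) (H∈ : H ∈T i) where

    secured-∈T : secured z Y G H ∈T i
    secured-∈T =
      (((h , ↑-∈T G G∈)
        , (↑-∈T (H ↑ ↑ ↑) (↑-∈T (H ↑ ↑) (↑-∈T (H ↑) (↑-∈T H H∈))) , tt) , tt , (tt , tt) , tt)
        , remaining-∈T (z ↑) (Y ↑) v0 τ≤i (↑-∈T z z∈) (↑-∈T Y Y∈) tt) , tt

    unsecured-∈T : unsecured z Y G H ∈T i
    unsecured-∈T =
      ((≤-trans (m≤n⊔m _ (level σ)) h , ↑-∈T (G ↑) (↑-∈T G G∈) , tt)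
        , (↑-∈T (H ↑ ↑ ↑) (↑-∈T (H ↑ ↑) (↑-∈T (H ↑) (↑-∈T H H∈))) , tt) , tt)
        , remaining-∈T (z ↑ ↑) (Y ↑ ↑) v1 τ≤i
            (↑-∈T (z ↑) (↑-∈T z z∈)) (↑-∈T (Y ↑) (↑-∈T Y Y∈)) tt

-- The recursors are at τ* → σ in G', at σ in H', at τ in `prepend` and at N in `monus`; the level
-- of the first bounds the others.
spector-∈T : ∀ {i} → level (τ * ⇒ σ) ≤ i →
             (z : Tm Γ (N ⇒ τ)) (Y : Tm Γ ((N ⇒ τ) ⇒ N)) →
             z ∈T i → Y ∈T i → spector σ z Y ∈T i
spector-∈T {i = i} h z Y z∈ Y∈ =
  ((tt , secured-∈T h (z ↑ ↑ ↑ ↑) (Y ↑ ↑ ↑ ↑) (↑⁴-∈T z z∈) (↑⁴-∈T Y Y∈) v2 v1 tt tt)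
    , unsecured-∈T h (z ↑ ↑ ↑ ↑) (Y ↑ ↑ ↑ ↑) (↑⁴-∈T z z∈) (↑⁴-∈T Y Y∈) v2 v1 tt tt) , tt
  where
  ↑⁴-∈T : ∀ {Γ ρ ρ₀ ρ₁ ρ₂ ρ₃} (a : Tm Γ ρ) → a ∈T i →
          _↑ {η = ρ₀} (_↑ {η = ρ₁} (_↑ {η = ρ₂} (_↑ {η = ρ₃} a))) ∈T i
  ↑⁴-∈T a p = ↑-∈T (a ↑ ↑ ↑) (↑-∈T (a ↑ ↑) (↑-∈T (a ↑) (↑-∈T a p)))

theorem2p4 :
    ∀ (τ σ : Ty) (t : Tm [] ((N ⇒ τ) ⇒ N)) →
    let i = (1 + level τ) ⊔ level σ in
    t ∈T i →
    Σ[ Φ ∈ Tm [] (BRTy τ σ ⇒ BRTy τ σ) ] ((Φ ∈T i) ×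
      (∀ {Γ : Ctx} (S : Pred Γ (τ *)) →
         [] ⊢ Bar S ∧ Secures S (closed t) ⊃
              ∀' (BRTy τ σ) (GBR (S ↑P) v0 ⊃ BR (closed Φ · v0) (closed t))))
-- `≤-refl` suffices because the level of τ* → σ computes to i.
theorem2p4 τ σ t t∈T = spector σ zeros t , spector-∈T ≤-refl zeros t (zeroObj-∈T τ) t∈T , λ {Γ} P →
  let Bar&Secures = Bar P ∧ Secures P (closed t)
      GBR-Δ       = GBR (P ↑P) v0
      hyps : List (Fm (BRTy τ σ ∷ Γ))
      hyps = GBR-Δ ∷ Bar&Secures ↑F ∷ []
  in ⊃I (∀I (⊃I (conv (BR-spector t)
     (⊃E (inst Split⊃Spector (v0 ◂ (zeros ◂ (closed t ◂ λ ())))) (∀I (∀I (∀I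
       -- This happens below the quantifiers over G, H and s, so the substitution shifts three times
       -- and `⊢-↑` carries both assumptions along.
       (split {P = P} {closed t} (λ x → var x ↑ ↑ ↑)
         (⊢-↑ {A = Bar&Secures} (λ x → var (there x) ↑ ↑)
           (⊢-↑ {A = Bar&Secures} (λ x → var (there x) ↑)
           (⊢-↑ {Θ = hyps} {A = Bar&Secures} (λ x → var (there x))
             (conv (renF≡subF there Bar&Secures) (hyp (there (here refl)))))))
         (⊢-↑ {A = GBR-Δ} (λ x → var x ↑ ↑) (⊢-↑ {A = GBR-Δ} (λ x → var x ↑)
           (⊢-↑ {Θ = hyps} {A = GBR-Δ} var (conv (sym (subF-var GBR-Δ)) (hyp (here refl))))))
         (trans (sub-closed _ t) (sym (trans (cong (λ a → a ↑ ↑) (↑-closed t))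
           (trans (cong _↑ (↑-closed t)) (↑-closed t)))))))))))))
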